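{- For all integers $k\ge 1$ and $\ell\ge 1$, there are only finitely many $k$-vertex-critical $(2P_2,(4,\ell)\text{ - }squid)$-free graphs.
   Context: Graphs are finite and simple, and "finitely many" means up to isomorphism. A graph $G$ is $k$-vertex-critical if $\chi(G)=k$ and $\chi(G-v)<k$ for all $v\in V(G)$, where $\chi$ denotes the chromatic number. A graph is $(H_1,H_2)$-free if it contains no induced subgraph isomorphic to $H_1$ or $H_2$. $2P_2$ is the disjoint union of two edges. For $\ell\ge 1$, the $(4,\ell)$-$squid$ is the graph obtained from the cycle $C_4$ by attaching $\ell$ leaves (pendant vertices) to a single vertex of the cycle. -}

module Defs where

open import Data.Bool using (Bool; true; false; _∨_)
open import Data.Bool.Properties using (∨-comm)
open import Data.Fin using (Fin; zero; suc; toℕ; splitAt; punchIn)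
open import Data.Fin.Properties using (punchIn-injective) renaming (_≟_ to _≟ᶠ_)
open import Data.List using (List)
open import Data.List.Relation.Unary.Any using (Any)
open import Data.Nat using (ℕ; zero; suc; pred; _+_; _≤_; _<_; _≡ᵇ_; _%_)
open import Data.Product using (Σ; ∃; ∃-syntax; _×_; _,_; proj₂)
open import Data.Sum using (_⊎_; inj₁; inj₂)
open import Function.Bundles using (_↣_; _↔_; mk↣; Injection; Inverse)
open import Relation.Binary.PropositionalEquality using (_≡_; _≢_; refl)
open import Relation.Nullary using (¬_)
open import Relation.Nullary.Decidable using (⌊_⌋)

record Graph (n : ℕ) : Set where
  field
    adj    : Fin n → Fin n → Bool
    sym    : ∀ u v → adj u v ≡ adj v u
    irrefl : ∀ v → adj v v ≡ false

open Graph

infix 4 _≅_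
_≅_ : ∀ {m n} → Graph m → Graph n → Set
_≅_ {m} {n} G H =
  Σ (Fin m ↔ Fin n) λ φ →
    ∀ u v → adj G u v ≡ adj H (Inverse.to φ u) (Inverse.to φ v)

-- The subgraph induced by a set of m vertices, the set being given by an
-- injective enumeration of its elements.
induced : ∀ {m n} → Graph n → Fin m ↣ Fin n → Graph m
induced G f = record
  { adj    = λ u v → adj G (Injection.to f u) (Injection.to f v)
  ; sym    = λ u v → sym G (Injection.to f u) (Injection.to f v)
  ; irrefl = λ v → irrefl G (Injection.to f v)
  }

infixl 6 _-ᵛ_
_-ᵛ_ : ∀ {n} → Graph n → Fin n → Graph (pred n)
_-ᵛ_ {suc n} G v = induced G (mk↣ (λ {i} {j} → punchIn-injective v i j))

_ContainsInduced_ : ∀ {m n} → Graph n → Graph m → Set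
_ContainsInduced_ {n = n} G H =
  ∃[ s ] Σ (Fin s ↣ Fin n) λ f → induced G f ≅ H

Free : ∀ {m₁ m₂ n} → Graph m₁ → Graph m₂ → Graph n → Set
Free H₁ H₂ G = ¬ (G ContainsInduced H₁) × ¬ (G ContainsInduced H₂)

Colourable : ∀ {n} → ℕ → Graph n → Set
Colourable {n} k G =
  Σ (Fin n → Fin k) λ c → ∀ u v → adj G u v ≡ true → c u ≢ c v

-- χ G ≔ k reads "the chromatic number of G is k".
χ_≔_ : ∀ {n} → Graph n → ℕ → Set
χ G ≔ k = Colourable k G × (∀ j → Colourable j G → k ≤ j)

VertexCritical : ∀ {n} → ℕ → Graph n → Set
VertexCritical k G =
  (χ G ≔ k) × (∀ v → ∃[ j ] (χ (G -ᵛ v) ≔ j) × j < k)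

-- Finiteness up to isomorphism: some finite list of graphs meets every
-- isomorphism class of graphs satisfying P.
FinitelyMany : (∀ {n} → Graph n → Set) → Set
FinitelyMany P =
  Σ (List (∃ Graph)) λ Gs →
    ∀ {n} (G : Graph n) → P G → Any (λ H → G ≅ proj₂ H) Gs

P₂ : Graph 2
P₂ = record
  { adj    = a
  ; sym    = λ { zero zero → refl ; zero (suc zero) → refl
               ; (suc zero) zero → refl ; (suc zero) (suc zero) → refl }
  ; irrefl = λ { zero → refl ; (suc zero) → refl }
  }
  where
  a : Fin 2 → Fin 2 → Bool
  a zero       zero       = false
  a zero       (suc zero) = true
  a (suc zero) zero       = true
  a (suc zero) (suc zero) = false

C₄ : Graph 4
C₄ = record
  { adj    = λ u v → next u v ∨ next v u
  ; sym    = λ u v → ∨-comm (next u v) (next v u)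
  ; irrefl = λ { zero → refl ; (suc zero) → refl
               ; (suc (suc zero)) → refl ; (suc (suc (suc zero))) → refl }
  }
  where
  next : Fin 4 → Fin 4 → Bool
  next u v = suc (toℕ u) % 4 ≡ᵇ toℕ v

-- Disjoint union; the vertices of G come first.
infixl 6 _⊕_
_⊕_ : ∀ {m n} → Graph m → Graph n → Graph (m + n)
_⊕_ {m} {n} G H = record
  { adj    = λ u v → a (splitAt m u) (splitAt m v)
  ; sym    = λ u v → a-sym (splitAt m u) (splitAt m v)
  ; irrefl = λ v → a-irrefl (splitAt m v)
  }
  where
  a : Fin m ⊎ Fin n → Fin m ⊎ Fin n → Bool
  a (inj₁ u) (inj₁ v) = adj G u v
  a (inj₂ u) (inj₂ v) = adj H u v
  a (inj₁ _) (inj₂ _) = false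
  a (inj₂ _) (inj₁ _) = false

  a-sym : ∀ u v → a u v ≡ a v u
  a-sym (inj₁ u) (inj₁ v) = sym G u v
  a-sym (inj₂ u) (inj₂ v) = sym H u v
  a-sym (inj₁ _) (inj₂ _) = refl
  a-sym (inj₂ _) (inj₁ _) = refl

  a-irrefl : ∀ v → a v v ≡ false
  a-irrefl (inj₁ v) = irrefl G v
  a-irrefl (inj₂ v) = irrefl H v

-- The vertices of G come first, then the ℓ leaves, each adjacent to w only.
attachLeaves : ∀ {n} → Graph n → Fin n → (ℓ : ℕ) → Graph (n + ℓ)
attachLeaves {n} G w ℓ = record
  { adj    = λ u v → a (splitAt n u) (splitAt n v)
  ; sym    = λ u v → a-sym (splitAt n u) (splitAt n v)
  ; irrefl = λ v → a-irrefl (splitAt n v)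
  }
  where
  a : Fin n ⊎ Fin ℓ → Fin n ⊎ Fin ℓ → Bool
  a (inj₁ u) (inj₁ v) = adj G u v
  a (inj₁ u) (inj₂ _) = ⌊ u ≟ᶠ w ⌋
  a (inj₂ _) (inj₁ v) = ⌊ v ≟ᶠ w ⌋
  a (inj₂ _) (inj₂ _) = false

  a-sym : ∀ u v → a u v ≡ a v u
  a-sym (inj₁ u) (inj₁ v) = sym G u v
  a-sym (inj₁ _) (inj₂ _) = refl
  a-sym (inj₂ _) (inj₁ _) = refl
  a-sym (inj₂ _) (inj₂ _) = refl

  a-irrefl : ∀ v → a v v ≡ false
  a-irrefl (inj₁ v) = irrefl G v
  a-irrefl (inj₂ _) = refl

2P₂ : Graph 4
2P₂ = P₂ ⊕ P₂

squid₄ : (ℓ : ℕ) → Graph (4 + ℓ)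
squid₄ ℓ = attachLeaves C₄ zero ℓ

-- Fix a k-colouring of G, an independent set S and a colour class T. As G is
-- 2P₂-free, the neighbourhoods in S of the vertices of T form a chain. Since G
-- is squid-free, those having at least two elements differ pairwise by at most
-- ℓ vertices, while the others cover at most one vertex. Up to a bounded number
-- of exceptions the vertices of S thus fall into two types with respect to T:
-- adjacent to all the members of T having at least two neighbours in S and to
-- no others, or adjacent to no member of T. Refining S in this way against every
-- colour class, a large S would yield two distinct vertices with the same
-- neighbourhood, which is impossible in a vertex-critical graph. So the colour
-- classes, and hence G, have bounded size.
module Submission where

open import Defs
open import Data.Bool using (Bool; true; false; not; _∧_; _∨_)
open import Data.Bool.Properties
  using (∨-comm; ∨-idem; ∧-identityʳ; ∧-zeroʳ; ¬-not; not-¬) renaming (_≟_ to _≟ᵇ_)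
open import Data.Empty using (⊥)
open import Data.Fin using (Fin; zero; suc; inject≤; punchOut; finToFun; funToFin)
  renaming (_<_ to _<ᶠ_)
open import Data.Fin.Properties
  using (2↔Bool; <⇒≢; <-cmp; inject≤-injective; punchIn-punchOut; finToFun-funToFin)
  renaming (_≟_ to _≟ᶠ_)
open import Data.List using (List; []; _∷_; length; filter; map; concatMap; upTo; allFin; lookup)
open import Data.List.Membership.Propositional using (_∈_; find; lose)
open import Data.List.Membership.Propositional.Properties
  using (∈-filter⁺; ∈-filter⁻; ∈-allFin; ∈-upTo⁺; ∈-lookup)
open import Data.List.Properties using (length-tabulate)
open import Data.List.Relation.Binary.Subset.Propositional using (_⊆_)
open import Data.List.Relation.Unary.All as All using ([]; _∷_)
open import Data.List.Relation.Unary.Any using (Any; here; there; any?)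
import Data.List.Relation.Unary.Any.Properties as Any
open import Data.List.Relation.Unary.Unique.Propositional using (Unique; []; _∷_)
import Data.List.Relation.Unary.Unique.Propositional.Properties as Unique
open import Data.Nat using (ℕ; zero; suc; _+_; _*_; _^_; _≤_; z≤n; s≤s; _≤?_)
open import Data.Nat.Properties using (+-suc; m≤n⇒m≤1+n; ≮⇒≥; <⇒≱)
open import Data.Product using (∃; ∃-syntax; ∃₂; _×_; _,_; proj₁; proj₂)
open import Data.Sum using (_⊎_; inj₁; inj₂; map₁; map₂)
open import Data.Vec using ([]; _∷_) renaming (lookup to lookupᵛ)
open import Function using (_∘_; Injective)
open import Function.Bundles using (Inverse; mk↣)
open import Function.Construct.Identity using (↔-id)
open import Level using (0ℓ)
open import Relation.Binary.Definitions using (tri<; tri≈; tri>)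
open import Relation.Binary.PropositionalEquality
  using (_≡_; _≢_; refl; sym; trans; cong; cong₂; subst; subst₂)
open import Relation.Nullary using (¬_; yes; no; does; contradiction)
open import Relation.Nullary.Decidable using (_×-dec_; dec-true; dec-false)
open import Relation.Unary using (Pred; Decidable)
open import Relation.Unary.Properties using (∁?)

open Graph using (adj; irrefl) renaming (sym to adj-sym)

-- Pigeonhole principles for lists.

module _ {A : Set} where

  -- Pigeonhole for two classes: each entry passes exactly one of the filters and so pays off one
  -- unit of `a` or of `b`.
  filter-split : {P : Pred A 0ℓ} (P? : Decidable P) (a b : ℕ) (xs : List A) →
    a + b ≤ length xs → a ≤ length (filter P? xs) ⊎ b ≤ length (filter (∁? P?) xs)
  filter-split P? zero    b       xs       _        = inj₁ z≤n
  filter-split P? (suc a) zero    xs       _        = inj₂ z≤n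
  filter-split P? (suc a) (suc b) (x ∷ xs) (s≤s le) with does (P? x)
  ... | true  = map₁ s≤s (filter-split P? a (suc b) xs le)
  ... | false = map₂ s≤s (filter-split P? (suc a) b xs (subst (_≤ length xs) (+-suc a b) le))

  distinct-pair : {xs : List A} → Unique xs → 2 ≤ length xs →
    ∃₂ λ a b → a ≢ b × a ∈ xs × b ∈ xs
  distinct-pair ((a≢b ∷ _) ∷ _) (s≤s (s≤s _)) = _ , _ , a≢b , here refl , there (here refl)

  filter-discard : {P : Pred A 0ℓ} (P? : Decidable P) (a : ℕ) {b : ℕ} (xs : List A) →
    ¬ (a ≤ length (filter P? xs)) → a + b ≤ length xs → b ≤ length (filter (∁? P?) xs)
  filter-discard P? a xs few le with filter-split P? a _ xs le
  ... | inj₁ many = contradiction many few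
  ... | inj₂ rest = rest

  two-members : {xs : List A} {a b : A} → a ≢ b → a ∈ xs → b ∈ xs → 2 ≤ length xs
  two-members {_ ∷ []}    a≢b (here refl) (here refl) = contradiction refl a≢b
  two-members {_ ∷ _ ∷ _} _   _           _           = s≤s (s≤s z≤n)

  lookup-injective : {xs : List A} → Unique xs → Injective _≡_ _≡_ (lookup xs)
  lookup-injective (_ ∷ _)    {zero}  {zero}  _  = refl
  lookup-injective (x≢ ∷ _)   {zero}  {suc j} eq = contradiction eq (All.lookup x≢ (∈-lookup j))
  lookup-injective (x≢ ∷ _)   {suc i} {zero}  eq = contradiction (sym eq) (All.lookup x≢ (∈-lookup i))
  lookup-injective (_ ∷ uniq) {suc i} {suc j} eq = cong suc (lookup-injective uniq eq)

  large-fibre : {k : ℕ} (c : A → Fin k) (m : ℕ) (is : List (Fin k)) {xs : List A} →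
    (∀ {x} → x ∈ xs → c x ∈ is) → Unique xs → suc (length is * m) ≤ length xs →
    ∃₂ λ i ys → (∀ {y} → y ∈ ys → c y ≡ i) × Unique ys × m ≤ length ys
  -- With no colours left, the `suc` in the bound still forces an entry of `xs`, whose colour has
  -- nowhere to lie.
  large-fibre c m []       {x ∷ xs} c∈ _ _ with () ← c∈ (here refl)
  large-fibre c m (i ∷ is) {xs} c∈ uniq big
    with filter-split (λ x → c x ≟ᶠ i) m (suc (length is * m)) xs
           (subst (_≤ length xs) (sym (+-suc m _)) big)
  ... | inj₁ le = i , _ , proj₂ ∘ ∈-filter⁻ (λ x → c x ≟ᶠ i) {xs = xs} , Unique.filter⁺ _ uniq , le
  ... | inj₂ le = large-fibre c m is c∈′ (Unique.filter⁺ _ uniq) le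
    where
    c∈′ : ∀ {x} → x ∈ filter (∁? (λ x → c x ≟ᶠ i)) xs → c x ∈ is
    c∈′ x∈ with ∈-filter⁻ (∁? (λ x → c x ≟ᶠ i)) {xs = xs} x∈
    ... | x∈xs , cx≢i with c∈ x∈xs
    ...   | here cx≡i  = contradiction cx≡i cx≢i
    ...   | there cx∈ = cx∈

-- Recognising induced copies of `2P₂` and of the squid.

module _ {n : ℕ} (G : Graph n) where

  separates : ∀ {x y z} → adj G x y ≡ true → adj G x z ≡ false → y ≢ z
  separates xy xz refl with () ← trans (sym xy) xz

  adjacent⇒≢ : ∀ {x y} → adj G x y ≡ true → x ≢ y
  adjacent⇒≢ {x} xy = separates xy (irrefl G x) ∘ sym

  swap-adj : ∀ {x y b} → adj G x y ≡ b → adj G y x ≡ b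
  swap-adj {x} {y} = trans (adj-sym G y x)

  -- Pairs with `i <ᶠ j` suffice: symmetry gives the reversed pairs and irreflexivity the diagonal.
  -- This halves the case analyses below.
  containsInduced : ∀ {m} (H : Graph m) (f : Fin m → Fin n) →
    (∀ {i j} → i <ᶠ j → f i ≢ f j × adj G (f i) (f j) ≡ adj H i j) →
    G ContainsInduced H
  containsInduced {m} H f h = m , mk↣ injective , ↔-id _ , same
    where
    injective : Injective _≡_ _≡_ f
    injective {i} {j} eq with <-cmp i j
    ... | tri< i<j _ _ = contradiction eq (proj₁ (h i<j))
    ... | tri≈ _ i≡j _ = i≡j
    ... | tri> _ _ j<i = contradiction (sym eq) (proj₁ (h j<i))

    same : ∀ i j → adj G (f i) (f j) ≡ adj H i j
    same i j with <-cmp i j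
    ... | tri< i<j _ _  = proj₂ (h i<j)
    ... | tri≈ _ refl _ = trans (irrefl G (f i)) (sym (irrefl H i))
    ... | tri> _ _ j<i  = trans (swap-adj (proj₂ (h j<i))) (adj-sym H j i)

  -- The two edges are `us` and `vt`. Distinctness comes from the adjacencies: any two of the four
  -- vertices are adjacent or separated by a third.
  contains-2P₂ : ∀ {u v s t} → adj G u v ≡ false → adj G s t ≡ false →
    adj G u s ≡ true → adj G v t ≡ true → adj G u t ≡ false → adj G v s ≡ false →
    G ContainsInduced 2P₂
  contains-2P₂ {u} {v} {s} {t} uv st us vt ut vs =
    containsInduced 2P₂ (lookupᵛ (u ∷ s ∷ v ∷ t ∷ [])) λ {i} {j} → h i j
    where
    h : ∀ i j → i <ᶠ j →
      lookupᵛ (u ∷ s ∷ v ∷ t ∷ []) i ≢ lookupᵛ (u ∷ s ∷ v ∷ t ∷ []) j ×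
      adj G (lookupᵛ (u ∷ s ∷ v ∷ t ∷ []) i) (lookupᵛ (u ∷ s ∷ v ∷ t ∷ []) j) ≡ adj 2P₂ i j
    h zero             (suc zero)             _ = adjacent⇒≢ us , us
    h zero             (suc (suc zero))       _ = separates (swap-adj us) (swap-adj vs) , uv
    h zero             (suc (suc (suc zero))) _ = separates (swap-adj us) st , ut
    h (suc zero)       (suc (suc zero))       _ = separates us uv , swap-adj vs
    h (suc zero)       (suc (suc (suc zero))) _ = separates us ut , st
    h (suc (suc zero)) (suc (suc (suc zero))) _ = adjacent⇒≢ vt , vt
    h (suc zero)       (suc zero)             (s≤s ())
    h (suc (suc zero)) (suc zero)             (s≤s ())
    h (suc (suc zero)) (suc (suc zero))       (s≤s (s≤s ()))
    h (suc (suc (suc zero))) (suc zero)       (s≤s ())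
    h (suc (suc (suc zero))) (suc (suc zero)) (s≤s (s≤s ()))
    h (suc (suc (suc zero))) (suc (suc (suc zero))) (s≤s (s≤s (s≤s ())))

  -- The cycle is `u`, `a`, `w`, `b` in this order, with the leaves at `u`. Adjacencies cannot tell
  -- the twins `a` and `b` apart, and only leaves, of which there may be none, separate `u` from
  -- `w`; hence the two explicit inequalities.
  contains-squid₄ : ∀ {ℓ u w a b} (leaf : Fin ℓ → Fin n) → Injective _≡_ _≡_ leaf →
    u ≢ w → a ≢ b →
    adj G u w ≡ false → adj G a b ≡ false →
    adj G u a ≡ true → adj G u b ≡ true → adj G w a ≡ true → adj G w b ≡ true →
    (∀ i → adj G u (leaf i) ≡ true) → (∀ i → adj G w (leaf i) ≡ false) →
    (∀ i → adj G a (leaf i) ≡ false) → (∀ i → adj G b (leaf i) ≡ false) →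
    (∀ i j → adj G (leaf i) (leaf j) ≡ false) →
    G ContainsInduced (squid₄ ℓ)
  contains-squid₄ {ℓ} {u} {w} {a} {b} leaf leaf-injective u≢w a≢b uw ab ua ub wa wb ul wl al bl ll =
    containsInduced (squid₄ ℓ) f λ {i} {j} → h i j
    where
    f : Fin (4 + ℓ) → Fin n
    f zero                      = u
    f (suc zero)                = a
    f (suc (suc zero))          = w
    f (suc (suc (suc zero)))    = b
    f (suc (suc (suc (suc i)))) = leaf i

    h : ∀ i j → i <ᶠ j → f i ≢ f j × adj G (f i) (f j) ≡ adj (squid₄ ℓ) i j
    h zero (suc zero)                _ = adjacent⇒≢ ua , ua
    h zero (suc (suc zero))          _ = u≢w , uw
    h zero (suc (suc (suc zero)))    _ = adjacent⇒≢ ub , ub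
    h zero (suc (suc (suc (suc i)))) _ = adjacent⇒≢ (ul i) , ul i
    h (suc zero) (suc (suc zero))          _ = adjacent⇒≢ (swap-adj wa) , swap-adj wa
    h (suc zero) (suc (suc (suc zero)))    _ = a≢b , ab
    h (suc zero) (suc (suc (suc (suc i)))) _ = separates wa (wl i) , al i
    h (suc (suc zero)) (suc (suc (suc zero)))    _ = adjacent⇒≢ wb , wb
    h (suc (suc zero)) (suc (suc (suc (suc i)))) _ = separates (swap-adj wa) (al i) , wl i
    h (suc (suc (suc zero))) (suc (suc (suc (suc i)))) _ = separates wb (wl i) , bl i
    h (suc (suc (suc (suc i)))) (suc (suc (suc (suc j)))) (s≤s (s≤s (s≤s (s≤s i<j)))) =
      <⇒≢ i<j ∘ leaf-injective , ll i j
    h (suc zero)                (suc zero)             (s≤s ())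
    h (suc (suc i))             (suc zero)             (s≤s ())
    h (suc (suc zero))          (suc (suc zero))       (s≤s (s≤s ()))
    h (suc (suc (suc i)))       (suc (suc zero))       (s≤s (s≤s ()))
    h (suc (suc (suc zero)))    (suc (suc (suc zero))) (s≤s (s≤s (s≤s ())))
    h (suc (suc (suc (suc i)))) (suc (suc (suc zero))) (s≤s (s≤s (s≤s ())))

  -- Refining one independent set against another.

  Independent : List (Fin n) → Set
  Independent S = ∀ {s t} → s ∈ S → t ∈ S → adj G s t ≡ false

  independent-⊆ : ∀ {S S′} → S′ ⊆ S → Independent S → Independent S′
  independent-⊆ sub ind s∈ t∈ = ind (sub s∈) (sub t∈)

  Homogeneous : List (Fin n) → List (Fin n) → Set
  Homogeneous S T = ∀ {s t u} → s ∈ S → t ∈ S → u ∈ T → adj G u s ≡ adj G u t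

  module Refinement {ℓ : ℕ} (free : Free 2P₂ (squid₄ ℓ) G) where

    -- The chain property in both polarities: the forbidden edges are `us` and `vt` for `b = true`,
    -- and `ut` and `vs` for `b = false`.
    uncrossed : ∀ b {u v s t} → adj G u v ≡ false → adj G s t ≡ false →
      adj G u s ≡ b → adj G v t ≡ b → adj G u t ≢ b → adj G v s ≢ b → ⊥
    uncrossed true uv st us vt ut vs =
      proj₁ free (contains-2P₂ uv st us vt (¬-not ut) (¬-not vs))
    uncrossed false uv st us vt ut vs =
      proj₁ free (contains-2P₂ (swap-adj uv) st (¬-not vs) (¬-not ut) vt us)

    -- For b = true this finds the top of a chain of neighbourhoods, for
    -- b = false its bottom.
    common-witness : ∀ b {u₀ T xs} → Independent T → Independent xs → u₀ ∈ T →
      (∀ {s} → s ∈ xs → ∃[ u ] u ∈ T × adj G u s ≡ b) →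
      ∃[ u ] u ∈ T × (∀ {s} → s ∈ xs → adj G u s ≡ b)
    common-witness b {xs = []} indT indX u₀∈ h = _ , u₀∈ , λ ()
    common-witness b {xs = x ∷ xs} indT indX u₀∈ h
      with common-witness b {xs = xs} indT (λ s t → indX (there s) (there t)) u₀∈ (h ∘ there)
         | h (here refl)
    ... | u , u∈ , us | v , v∈ , vx with adj G u x ≟ᵇ b
    ...   | yes ux = u , u∈ , λ { (here refl) → ux ; (there s∈) → us s∈ }
    -- The witness `v` for `x` takes over: an `s` on which `v` failed would cross with `x`, on which
    -- `u` fails.
    ...   | no ux  = v , v∈ , λ { (here refl) → vx ; (there s∈) → vs s∈ }
      where
      vs : ∀ {s} → s ∈ xs → adj G v s ≡ b
      vs {s} s∈ with adj G v s ≟ᵇ b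
      ... | yes eq = eq
      ... | no neq = contradiction neq
                      (uncrossed b (indT u∈ v∈) (indX (there s∈) (here refl)) (us s∈) vx ux)

    -- A member `x` of `xs` is adjacent to `u` but not to `w`, so by the chain property `u` is
    -- adjacent to `a` and `b` as well. Then `u`, `a`, `w`, `b` form a four-cycle, and members of
    -- `xs` are leaves at `u`. The bound `suc ℓ` provides such an `x` even when `ℓ` is zero.
    few-distinguishing : ∀ {u w a b xs} → Independent (a ∷ b ∷ xs) → a ≢ b → Unique xs →
      adj G u w ≡ false → adj G w a ≡ true → adj G w b ≡ true →
      (∀ {x} → x ∈ xs → adj G u x ≡ true) → (∀ {x} → x ∈ xs → adj G w x ≡ false) →
      ¬ (suc ℓ ≤ length xs)
    few-distinguishing {u} {w} {a} {b} {x ∷ xs} ind a≢b uniq uw wa wb ux wx (s≤s ℓ≤) =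
      proj₂ free (contains-squid₄ leaf leaf-injective u≢w a≢b uw
        (ind (here refl) (there (here refl))) (u~ (here refl) wa) (u~ (there (here refl)) wb) wa wb
        (ux ∘ leaf∈) (wx ∘ leaf∈)
        (ind (here refl) ∘ there ∘ there ∘ leaf∈) (ind (there (here refl)) ∘ there ∘ there ∘ leaf∈)
        (λ i j → ind (there (there (leaf∈ i))) (there (there (leaf∈ j)))))
      where
      u≢w : u ≢ w
      u≢w = separates (swap-adj (ux (here refl))) (swap-adj (wx (here refl)))

      ℓ≤′ : ℓ ≤ length (x ∷ xs)
      ℓ≤′ = m≤n⇒m≤1+n ℓ≤

      leaf : Fin ℓ → Fin n
      leaf i = lookup (x ∷ xs) (inject≤ i ℓ≤′)

      leaf∈ : ∀ i → leaf i ∈ x ∷ xs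
      leaf∈ i = ∈-lookup (inject≤ i ℓ≤′)

      leaf-injective : Injective _≡_ _≡_ leaf
      leaf-injective {i} {j} eq = inject≤-injective ℓ≤′ ℓ≤′ i j (lookup-injective uniq eq)

      u~ : ∀ {c} → c ∈ a ∷ b ∷ x ∷ xs → adj G w c ≡ true → adj G u c ≡ true
      u~ {c} c∈ wc with adj G u c ≟ᵇ true
      ... | yes uc = uc
      ... | no uc with () ← uncrossed true uw (ind (there (there (here refl))) c∈) (ux (here refl)) wc uc
                              (not-¬ (wx (here refl)))

    module _ {S T : List (Fin n)} (indS : Independent S) (indT : Independent T) (uniqS : Unique S) where

      nbrs : Fin n → List (Fin n)
      nbrs u = filter (λ s → adj G u s ≟ᵇ true) S

      Big : Pred (Fin n) 0ℓ
      Big u = 2 ≤ length (nbrs u)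

      big? : Decidable Big
      big? u = 2 ≤? length (nbrs u)

      bigs smalls : List (Fin n)
      bigs   = filter big? T
      smalls = filter (∁? big?) T

      bigs⊆T : bigs ⊆ T
      bigs⊆T = proj₁ ∘ ∈-filter⁻ big? {xs = T}

      smalls⊆T : smalls ⊆ T
      smalls⊆T = proj₁ ∘ ∈-filter⁻ (∁? big?) {xs = T}

      Hits : Bool → List (Fin n) → Pred (Fin n) 0ℓ
      Hits b U s = Any (λ u → adj G u s ≡ b) U

      hits? : ∀ b U → Decidable (Hits b U)
      hits? b U s = any? (λ u → adj G u s ≟ᵇ b) U

      Mixed : Pred (Fin n) 0ℓ
      Mixed s = Hits true bigs s × Hits false bigs s

      mixed? : Decidable Mixed
      mixed? s = hits? true bigs s ×-dec hits? false bigs s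

      -- The top of the chain formed by `smalls` would be adjacent to all of `xs`; with two
      -- neighbours in `S` it would be big.
      few-small-hits : ∀ {xs} → xs ⊆ S → Unique xs → (∀ {s} → s ∈ xs → Hits true smalls s) →
        ¬ (2 ≤ length xs)
      few-small-hits {xs} xs⊆S uniq hits 2≤ =
        let a , b , a≢b , a∈ , b∈ = distinct-pair uniq 2≤
            _ , u₀∈ , _ = find (hits a∈)
            u , u∈ , us = common-witness true
                            (independent-⊆ smalls⊆T indT) (independent-⊆ xs⊆S indS) u₀∈ (find ∘ hits)
        in proj₂ (∈-filter⁻ (∁? big?) {xs = T} u∈)
             (two-members a≢b (∈-filter⁺ _ (xs⊆S a∈) (us a∈))
                              (∈-filter⁺ _ (xs⊆S b∈) (us b∈)))

      -- In the chain formed by `bigs`, the top `u` is adjacent to all of `xs` and the bottom `w` to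
      -- none. As `w` is big, it has two neighbours `a` and `b` in `S`, which close the cycle of a
      -- squid.
      few-mixed : ∀ {xs} → xs ⊆ S → Unique xs → (∀ {s} → s ∈ xs → Mixed s) →
        ¬ (suc ℓ ≤ length xs)
      few-mixed {xs@(x ∷ _)} xs⊆S uniq mixed ℓ< =
        let _ , u₀∈ , _ = find (proj₁ (mixed (here refl)))
            u , u∈ , us = common-witness true indB indX u₀∈ (find ∘ proj₁ ∘ mixed)
            w , w∈ , ws = common-witness false indB indX u₀∈ (find ∘ proj₂ ∘ mixed)
            a , b , a≢b , a∈ , b∈ = distinct-pair (Unique.filter⁺ _ uniqS) (proj₂ (∈-filter⁻ big? {xs = T} w∈))
            a∈S , wa = ∈-filter⁻ (λ s → adj G w s ≟ᵇ true) {xs = S} a∈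
            b∈S , wb = ∈-filter⁻ (λ s → adj G w s ≟ᵇ true) {xs = S} b∈
        in few-distinguishing
             (independent-⊆ (λ { (here refl) → a∈S ; (there (here refl)) → b∈S ; (there (there p)) → xs⊆S p }) indS)
             a≢b uniq (indB u∈ w∈) wa wb us ws ℓ<
        where
        indB : Independent bigs
        indB = independent-⊆ bigs⊆T indT

        indX : Independent xs
        indX = independent-⊆ xs⊆S indS

      S₁ S₂ : List (Fin n)
      S₁ = filter (∁? (hits? true smalls)) S
      S₂ = filter (∁? mixed?) S₁

      uniqS₁ : Unique S₁
      uniqS₁ = Unique.filter⁺ (∁? (hits? true smalls)) uniqS

      uniqS₂ : Unique S₂
      uniqS₂ = Unique.filter⁺ (∁? mixed?) uniqS₁

      S₁⊆S : S₁ ⊆ S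
      S₁⊆S = proj₁ ∘ ∈-filter⁻ (∁? (hits? true smalls)) {xs = S}

      S₂⊆S₁ : S₂ ⊆ S₁
      S₂⊆S₁ = proj₁ ∘ ∈-filter⁻ (∁? mixed?) {xs = S₁}

      -- The `2` pays for the vertices hit by `smalls`, the `suc ℓ` for the mixed ones.
      length-S₂ : ∀ {m} → 2 + (suc ℓ + m) ≤ length S → m ≤ length S₂
      length-S₂ =
        filter-discard mixed? (suc ℓ) S₁
          (few-mixed (S₁⊆S ∘ proj₁ ∘ ∈-filter⁻ mixed? {xs = S₁})
            (Unique.filter⁺ mixed? uniqS₁) (proj₂ ∘ ∈-filter⁻ mixed? {xs = S₁}))
        ∘ filter-discard (hits? true smalls) 2 S
          (few-small-hits (proj₁ ∘ ∈-filter⁻ (hits? true smalls) {xs = S})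
            (Unique.filter⁺ (hits? true smalls) uniqS) (proj₂ ∘ ∈-filter⁻ (hits? true smalls) {xs = S}))

      adj-small : ∀ {s u} → s ∈ S₁ → u ∈ T → ¬ Big u → adj G u s ≡ false
      adj-small s∈ u∈ small =
        ¬-not (proj₂ (∈-filter⁻ (∁? (hits? true smalls)) {xs = S} s∈) ∘ lose (∈-filter⁺ (∁? big?) u∈ small))

      -- Vertices of `S₂` are not mixed, so one hit by some big vertex is hit by all of them. The
      -- value depends on `u` alone, which is what homogeneity requires.
      adj-hit : ∀ {s u} → s ∈ filter (hits? true bigs) S₂ → u ∈ T → adj G u s ≡ does (big? u)
      adj-hit {s} {u} s∈ u∈ with big? u | ∈-filter⁻ (hits? true bigs) {xs = S₂} s∈
      ... | no small | s∈S₂ , _   =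
        trans (adj-small (S₂⊆S₁ s∈S₂) u∈ small) (sym (dec-false (big? u) small))
      ... | yes big  | s∈S₂ , hit =
        trans (¬-not λ us → proj₂ (∈-filter⁻ (∁? mixed?) {xs = S₁} s∈S₂) (hit , lose (∈-filter⁺ big? u∈ big) us))
              (sym (dec-true (big? u) big))

      adj-miss : ∀ {s u} → s ∈ filter (∁? (hits? true bigs)) S₂ → u ∈ T → adj G u s ≡ false
      adj-miss {s} {u} s∈ u∈ with big? u | ∈-filter⁻ (∁? (hits? true bigs)) {xs = S₂} s∈
      ... | no small | s∈S₂ , _   = adj-small (S₂⊆S₁ s∈S₂) u∈ small
      ... | yes big  | s∈S₂ , miss = ¬-not (miss ∘ lose (∈-filter⁺ big? u∈ big))

      -- Of the two types of vertices in `S₂`, hit or missed by `bigs`, one has at least `m`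
      -- members; hence `m + m`.
      refine : ∀ m → 2 + (suc ℓ + (m + m)) ≤ length S →
        ∃[ S′ ] S′ ⊆ S × Unique S′ × m ≤ length S′ × Homogeneous S′ T
      refine m le with filter-split (hits? true bigs) m m S₂ (length-S₂ le)
      ... | inj₁ m≤ =
        _ , S₁⊆S ∘ S₂⊆S₁ ∘ proj₁ ∘ ∈-filter⁻ (hits? true bigs) {xs = S₂} , Unique.filter⁺ _ uniqS₂ , m≤ ,
        λ s∈ t∈ u∈ → trans (adj-hit s∈ u∈) (sym (adj-hit t∈ u∈))
      ... | inj₂ m≤ =
        _ , S₁⊆S ∘ S₂⊆S₁ ∘ proj₁ ∘ ∈-filter⁻ (∁? (hits? true bigs)) {xs = S₂} , Unique.filter⁺ _ uniqS₂ , m≤ ,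
        λ s∈ t∈ u∈ → trans (adj-miss s∈ u∈) (sym (adj-miss t∈ u∈))

-- Refinement against all colour classes.

-- The size needed to survive refinement against that many classes and still keep two vertices; the
-- successor clause is the demand of `refine`.
independent-bound : ℕ → ℕ → ℕ
independent-bound ℓ zero    = 2
independent-bound ℓ (suc i) = 2 + (suc ℓ + (independent-bound ℓ i + independent-bound ℓ i))

module _ {n k : ℕ} (G : Graph n) {ℓ : ℕ} (free : Free 2P₂ (squid₄ ℓ) G) (colouring : Colourable k G) where

  private
    c : Fin n → Fin k
    c = proj₁ colouring

  monochromatic⇒independent : ∀ {i S} → (∀ {s} → s ∈ S → c s ≡ i) → Independent G S
  monochromatic⇒independent mono {s} {t} s∈ t∈ =
    ¬-not λ st → proj₂ colouring s t st (trans (mono s∈) (sym (mono t∈)))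

  refine-all : ∀ is {S} → Independent G S → Unique S → independent-bound ℓ (length is) ≤ length S →
    ∃[ S′ ] Unique S′ × 2 ≤ length S′ × S′ ⊆ S ×
      (∀ {s t u} → s ∈ S′ → t ∈ S′ → c u ∈ is → adj G u s ≡ adj G u t)
  refine-all [] ind uniq le = _ , uniq , le , (λ s∈ → s∈) , λ _ _ ()
  refine-all (i ∷ is) ind uniq le =
    let inClass = λ u → c u ≟ᶠ i
        -- The set refined against is the whole colour class of `i`. Homogeneity passes to subsets,
        -- so later refinements preserve it.
        S₁ , S₁⊆S , uniq₁ , le₁ , hom₁ =
          Refinement.refine G free ind
            (monochromatic⇒independent (proj₂ ∘ ∈-filter⁻ inClass {xs = allFin n})) uniq _ le
        S₂ , uniq₂ , le₂ , S₂⊆S₁ , hom₂ = refine-all is (independent-⊆ G S₁⊆S ind) uniq₁ le₁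
    in S₂ , uniq₂ , le₂ , S₁⊆S ∘ S₂⊆S₁ , λ where
         s∈ t∈ (here cu≡i)  → hom₁ (S₂⊆S₁ s∈) (S₂⊆S₁ t∈) (∈-filter⁺ inClass (∈-allFin _) cu≡i)
         s∈ t∈ (there cu∈) → hom₂ s∈ t∈ cu∈

  -- Some colour class is large. Refining it against every class, its own included, leaves two
  -- vertices that no coloured vertex, hence no vertex at all, distinguishes.
  exists-twins : suc (k * independent-bound ℓ k) ≤ n →
    ∃₂ λ s t → s ≢ t × (∀ u → adj G u s ≡ adj G u t)
  exists-twins le =
    let length-is = length-tabulate {n = k} (λ i → i)
        i , S , mono , uniq , le₁ =
          large-fibre c (independent-bound ℓ k) (allFin k) {allFin n} (λ _ → ∈-allFin _) (Unique.allFin⁺ n)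
            (subst₂ (λ a b → suc (a * independent-bound ℓ k) ≤ b)
              (sym length-is) (sym (length-tabulate {n = n} (λ i → i))) le)
        S′ , uniq′ , le′ , _ , hom =
          refine-all (allFin k) (monochromatic⇒independent mono) uniq
            (subst (λ a → independent-bound ℓ a ≤ length S) (sym length-is) le₁)
        s , t , s≢t , s∈ , t∈ = distinct-pair uniq′ le′
    in s , t , s≢t , λ u → hom s∈ t∈ (∈-allFin (c u))

-- Twins in vertex-critical graphs.

-- A colouring of `G -ᵛ s` with fewer than `k` colours extends to `G` by giving `s` the colour of
-- its twin `t`, against the minimality of `k`.
critical⇒twin-free : ∀ {n k} (G : Graph n) → VertexCritical k G →
  ∀ {s t} → s ≢ t → ¬ (∀ u → adj G u s ≡ adj G u t)
critical⇒twin-free {suc n} G ((_ , minimal) , critical) {s} {t} s≢t twins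
  with critical s
... | j , ((c , proper) , _) , j<k = <⇒≱ j<k (minimal j (d , d-proper))
  where
  d : Fin (suc n) → Fin j
  d v with s ≟ᶠ v
  ... | yes _   = c (punchOut s≢t)
  ... | no  s≢v = c (punchOut s≢v)

  c-proper : ∀ {u v} (s≢u : s ≢ u) (s≢v : s ≢ v) → adj G u v ≡ true →
    c (punchOut s≢u) ≢ c (punchOut s≢v)
  c-proper s≢u s≢v uv =
    proper _ _ (trans (cong₂ (adj G) (punchIn-punchOut s≢u) (punchIn-punchOut s≢v)) uv)

  d-proper : ∀ u v → adj G u v ≡ true → d u ≢ d v
  d-proper u v uv with s ≟ᶠ u | s ≟ᶠ v
  ... | no s≢u   | no s≢v   = c-proper s≢u s≢v uv
  ... | no s≢u   | yes refl = c-proper s≢u s≢t (trans (sym (twins u)) uv)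
  ... | yes refl | no s≢v   = c-proper s≢t s≢v (swap-adj G (trans (sym (twins v)) (swap-adj G uv)))
  ... | yes refl | yes refl = contradiction refl (adjacent⇒≢ G uv)

-- Finitely many graphs of bounded order.

-- Arbitrary Boolean matrices are symmetrised and cleared on the diagonal, which
-- leaves adjacency matrices unchanged.
fromMatrix : ∀ {n} → (Fin n → Fin n → Bool) → Graph n
fromMatrix a = record
  { adj    = λ u v → (a u v ∨ a v u) ∧ not (does (u ≟ᶠ v))
  ; sym    = λ u v → cong₂ (λ x y → x ∧ not y) (∨-comm (a u v) (a v u)) (≟-sym u v)
  ; irrefl = λ v → trans (cong (λ y → (a v v ∨ a v v) ∧ not y) (dec-true (v ≟ᶠ v) refl))
                         (∧-zeroʳ (a v v ∨ a v v))
  }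
  where
  ≟-sym : ∀ {n} (u v : Fin n) → does (u ≟ᶠ v) ≡ does (v ≟ᶠ u)
  ≟-sym u v with u ≟ᶠ v
  ... | yes refl = sym (dec-true (u ≟ᶠ u) refl)
  ... | no u≢v   = sym (dec-false (v ≟ᶠ u) (u≢v ∘ sym))

≅-fromMatrix : ∀ {n} (G : Graph n) (a : Fin n → Fin n → Bool) →
  (∀ u v → a u v ≡ adj G u v) → G ≅ fromMatrix a
≅-fromMatrix G a a≡ = ↔-id _ , same
  where
  same : ∀ u v → adj G u v ≡ (a u v ∨ a v u) ∧ not (does (u ≟ᶠ v))
  same u v rewrite a≡ u v | a≡ v u | adj-sym G v u | ∨-idem (adj G u v) with u ≟ᶠ v
  ... | yes refl = trans (irrefl G u) (sym (∧-zeroʳ (adj G u u)))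
  ... | no _     = sym (∧-identityʳ (adj G u v))

-- A number below `(2 ^ n) ^ n` encodes `n` rows, each a number below `2 ^ n` encoding `n` bits, so
-- `allFin` enumerates all matrices.
decode : ∀ {n} → Fin ((2 ^ n) ^ n) → Graph n
decode x = fromMatrix (λ u v → Inverse.to 2↔Bool (finToFun (finToFun x u) v))

≅-decode : ∀ {n} (G : Graph n) → ∃[ x ] G ≅ decode x
≅-decode {n} G = funToFin row , ≅-fromMatrix G _ λ u v →
  trans (cong (λ r → Inverse.to 2↔Bool (finToFun r v)) (finToFun-funToFin row u))
    (trans (cong (Inverse.to 2↔Bool) (finToFun-funToFin (λ v → Inverse.from 2↔Bool (adj G u v)) v))
      (Inverse.strictlyInverseˡ 2↔Bool (adj G u v)))
  where
  row : Fin n → Fin (2 ^ n)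
  row u = funToFin (λ v → Inverse.from 2↔Bool (adj G u v))

bounded-order⇒finitelyMany : {P : ∀ {n} → Graph n → Set} (N : ℕ) →
  (∀ {n} (G : Graph n) → P G → n ≤ N) → FinitelyMany P
bounded-order⇒finitelyMany N bounded = concatMap graphs (upTo (suc N)) , λ {n} G pG →
  let x , iso = ≅-decode G in
  Any.concatMap⁺ graphs
    (lose (∈-upTo⁺ (s≤s (bounded G pG))) (Any.map⁺ (lose (∈-allFin x) iso)))
  where
  graphs : ℕ → List (∃ Graph)
  graphs n = map (λ x → n , decode x) (allFin ((2 ^ n) ^ n))

theorem4p2 : (k ℓ : ℕ) → 1 ≤ k → 1 ≤ ℓ →
    FinitelyMany (λ G → VertexCritical k G × Free 2P₂ (squid₄ ℓ) G)
theorem4p2 k ℓ _ _ = bounded-order⇒finitelyMany (k * independent-bound ℓ k) λ G (critical , free) →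
  ≮⇒≥ λ large →
    let _ , _ , s≢t , twins = exists-twins G free (proj₁ (proj₁ critical)) large
    in critical⇒twin-free G critical s≢t twins
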